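{- Let $n\ge 1$ be an integer and let $P_n$ denote the path on $n$ vertices. For any $x\in\mathbb{N}$ and any integer $y$ with $0\le y\le x$, except for the case $x=y=1$, we have \[ P(P_n,x,y) = \frac{\sqrt{(x+1)^2-4y}-x-1}{2\sqrt{(x+1)^2-4y}}\cdot \left( \frac{x-1-\sqrt{(x+1)^2-4y}}{2} \right)^n + \frac{\sqrt{(x+1)^2-4y}+x+1}{2\sqrt{(x+1)^2-4y}}\cdot \left( \frac{x-1+\sqrt{(x+1)^2-4y}}{2} \right)^n . \]
   Context: For a finite simple graph $G=(V,E)$, $x\in\mathbb{N}$ and $y\in\{0,\dots,x\}$, the bivariate chromatic polynomial $P(G,x,y)$ is the number of maps $f:V\to\{1,\dots,x\}$ such that for every edge $\{v,w\}\in E$, either $f(v)\neq f(w)$ or $f(v)=f(w)>y$. (Equivalently: colorings in which adjacent vertices receive different colors or share a color from $\{y+1,\dots,x\}$.) -}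

module Defs where

open import Algebra.Bundles.Raw using (RawRing)
open import Data.Empty using (⊥-elim)
open import Data.Fin.Base using (Fin; toℕ)
import Data.Fin.Properties as Fin
import Data.Integer.Base as ℤ
import Data.Integer.Properties as ℤ
open import Data.List.Base using (List; []; _∷_; [_]; length; filter; allFin; cartesianProductWith)
open import Data.List.Membership.Propositional using (_∈_)
open import Data.List.Membership.Propositional.Properties using (∈-allFin; ∈-cartesianProductWith⁺)
open import Data.List.Relation.Unary.All using ([])
open import Data.List.Relation.Unary.Any using (here)
open import Data.List.Relation.Unary.AllPairs using ([]; _∷_)
open import Data.List.Relation.Unary.Unique.Propositional using (Unique)
open import Data.List.Relation.Unary.Unique.Propositional.Properties
  using (allFin⁺; cartesianProductWith⁺)
open import Data.Nat.Base as ℕ using (ℕ; zero; suc)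
import Data.Nat.Properties as ℕ
open import Data.Product.Base using (∃-syntax; _×_; _,_)
open import Data.Rational as ℚ using (ℚ; 0ℚ; 1ℚ; ½)
import Data.Rational.Properties as ℚ
import Data.Rational.Solver
import Data.Rational.Unnormalised.Base as ℚᵘ
import Data.Rational.Unnormalised.Properties as ℚᵘ
open import Data.Sum.Base using (_⊎_; inj₁; inj₂)
open import Data.Vec.Base using (Vec; []; _∷_; lookup)
open import Data.Vec.Properties using (∷-injective)
open import Level using (0ℓ)
open import Relation.Binary.Core using (Rel)
open import Relation.Binary.Definitions using (Decidable; Symmetric; Irreflexive)
open import Relation.Binary.PropositionalEquality
  using (_≡_; _≢_; refl; sym; trans; cong; cong₂; subst; subst₂)
open import Relation.Nullary using (Dec; yes; no; ¬_)
open import Relation.Nullary.Decidable using (decidable-stable; ¬?; _×-dec_; _⊎-dec_; _→-dec_)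

record SimpleGraph (n : ℕ) : Set₁ where
  infix 4 _~_ _~?_
  field
    _~_      : Rel (Fin n) 0ℓ
    _~?_     : Decidable _~_
    ~-sym    : Symmetric _~_
    ~-irrefl : Irreflexive _≡_ _~_

path : ∀ n → SimpleGraph n
path n = record
  { _~_      = λ i j → toℕ j ≡ suc (toℕ i) ⊎ toℕ i ≡ suc (toℕ j)
  ; _~?_     = λ i j → (toℕ j ℕ.≟ suc (toℕ i)) ⊎-dec (toℕ i ℕ.≟ suc (toℕ j))
  ; ~-sym    = λ { (inj₁ p) → inj₂ p ; (inj₂ p) → inj₁ p }
  ; ~-irrefl = λ { refl (inj₁ p) → ℕ.1+n≢n (sym p) ; refl (inj₂ p) → ℕ.1+n≢n (sym p) }
  }

-- The colours 1, …, x are the elements of Fin x, shifted by one.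
colour : ∀ {x} → Fin x → ℕ
colour c = suc (toℕ c)

module _ {n : ℕ} (G : SimpleGraph n) where
  open SimpleGraph G

  IsColouring : (x y : ℕ) → Vec (Fin x) n → Set
  IsColouring x y f = ∀ v w → v ~ w →
    lookup f v ≢ lookup f w ⊎
    (lookup f v ≡ lookup f w × y ℕ.< colour (lookup f v))

  isColouring? : ∀ x y f → Dec (IsColouring x y f)
  isColouring? x y f = Fin.all? λ v → Fin.all? λ w → (v ~? w) →-dec
    (¬? (lookup f v Fin.≟ lookup f w) ⊎-dec
     ((lookup f v Fin.≟ lookup f w) ×-dec (y ℕ.<? colour (lookup f v))))

-- Maps Fin n → Fin x are represented by vectors, on which _≡_ is extensional.
allMaps : ∀ n x → List (Vec (Fin x) n)
allMaps zero    x = [ [] ]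
allMaps (suc n) x = cartesianProductWith _∷_ (allFin x) (allMaps n x)

allMaps-complete : ∀ {n x} (f : Vec (Fin x) n) → f ∈ allMaps n x
allMaps-complete []      = here refl
allMaps-complete (c ∷ f) = ∈-cartesianProductWith⁺ _∷_ (∈-allFin c) (allMaps-complete f)

allMaps-unique : ∀ n x → Unique (allMaps n x)
allMaps-unique zero    x = [] ∷ []
allMaps-unique (suc n) x =
  cartesianProductWith⁺ _∷_ ∷-injective (allFin⁺ x) (allMaps-unique n x)

P : ∀ {n} → SimpleGraph n → ℕ → ℕ → ℕ
P {n} G x y = length (filter (isColouring? G x y) (allMaps n x))

Cauchy : (ℕ → ℚ) → Set
Cauchy s = ∀ ε → 0ℚ ℚ.< ε →
  ∃[ N ] ∀ m n → N ℕ.≤ m → N ℕ.≤ n → ℚ.∣ s m ℚ.- s n ∣ ℚ.< ε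

fromℕ-ℚ : ℕ → ℚ
fromℕ-ℚ n = ℤ.+ n ℚ./ 1

recip : ℚ → ℚ
recip q with q ℚ.≟ 0ℚ
... | yes _   = 0ℚ
... | no  q≢0 = ℚ.1/_ q {{ℚ.≢-nonZero q≢0}}

½^ : ℕ → ℚ
½^ zero    = 1ℚ
½^ (suc n) = ½ ℚ.* ½^ n

-- For q ≥ 0, bisection of [ 0 , q + 1 ]: after n steps the square root of q
-- lies in [ lower q n , lower q n + width q n ).
width : ℚ → ℕ → ℚ
width q n = (q ℚ.+ 1ℚ) ℚ.* ½^ n

lower : ℚ → ℕ → ℚ
lower q zero    = 0ℚ
lower q (suc n) with (lower q n ℚ.+ width q (suc n)) ℚ.* (lower q n ℚ.+ width q (suc n)) ℚ.≤? q
... | yes _ = lower q n ℚ.+ width q (suc n)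
... | no  _ = lower q n

module _ where
  open import Data.Rational
    using (_+_; _*_; _-_; -_; _<_; _≤_; ∣_∣; _⊔_; 1/_; Positive; NonNegative; positive; nonNegative)
  open Data.Rational.Solver.+-*-Solver
    using (solve; _:=_; _:+_; _:*_; _:-_; :-_; con)

  ⊔≤ˡ : ∀ m n {k} → m ℕ.⊔ n ℕ.≤ k → m ℕ.≤ k
  ⊔≤ˡ m n = ℕ.≤-trans (ℕ.m≤m⊔n m n)

  ⊔≤ʳ : ∀ m n {k} → m ℕ.⊔ n ℕ.≤ k → n ℕ.≤ k
  ⊔≤ʳ m n = ℕ.≤-trans (ℕ.m≤n⊔m m n)

  half-pos : ∀ {ε} → 0ℚ < ε → 0ℚ < ½ * ε
  half-pos {ε} 0<ε = subst (_< ½ * ε) (ℚ.*-zeroʳ ½) (ℚ.*-monoʳ-<-pos ½ 0<ε)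

  half+half : ∀ ε → ½ * ε + ½ * ε ≡ ε
  half+half = solve 1 (λ ε → con ½ :* ε :+ con ½ :* ε := ε) refl

  neg-flip : ∀ p q → p - q ≡ - (q - p)
  neg-flip = solve 2 (λ p q → p :- q := :- (q :- p)) refl

  neg-neg : ∀ p q → q - p ≡ (- p) - (- q)
  neg-neg = solve 2 (λ p q → q :- p := (:- p) :- (:- q)) refl

  p+[q-p] : ∀ p q → p + (q - p) ≡ q
  p+[q-p] = solve 2 (λ p q → p :+ (q :- p) := q) refl

  [q-p]+p : ∀ p q → (q - p) + p ≡ q
  [q-p]+p = solve 2 (λ p q → (q :- p) :+ p := q) refl

  [p+q]-p : ∀ p q → (p + q) - p ≡ q
  [p+q]-p = solve 2 (λ p q → (p :+ q) :- p := q) refl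

  +-diff : ∀ a b c d → (a - c) + (b - d) ≡ (a + b) - (c + d)
  +-diff = solve 4 (λ a b c d → (a :- c) :+ (b :- d) := (a :+ b) :- (c :+ d)) refl

  *-diff : ∀ a b c d → (a - c) * b + (b - d) * c ≡ a * b - c * d
  *-diff = solve 4 (λ a b c d → (a :- c) :* b :+ (b :- d) :* c := a :* b :- c :* d) refl

  recip-diff : ∀ a b u v → b * (a * u) - a * (b * v) ≡ (u - v) * (a * b)
  recip-diff = solve 4 (λ a b u v →
    b :* (a :* u) :- a :* (b :* v) := (u :- v) :* (a :* b)) refl

  half-step : ∀ h k → ½ * (h * k) + ½ * h ≡ (½ * h) * (1ℚ + k)
  half-step = solve 2 (λ h k →
    con ½ :* (h :* k) :+ con ½ :* h := (con ½ :* h) :* (con 1ℚ :+ k)) refl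

  halves : ∀ c h → c * (½ * h) + c * (½ * h) ≡ c * h
  halves = solve 2 (λ c h → c :* (con ½ :* h) :+ c :* (con ½ :* h) := c :* h) refl

  [q+1]² : ∀ q → (q + 1ℚ) + (q * q + q) ≡ (0ℚ + (q + 1ℚ) * 1ℚ) * (0ℚ + (q + 1ℚ) * 1ℚ)
  [q+1]² = solve 1 (λ q → (q :+ con 1ℚ) :+ (q :* q :+ q)
    := (con 0ℚ :+ (q :+ con 1ℚ) :* con 1ℚ) :* (con 0ℚ :+ (q :+ con 1ℚ) :* con 1ℚ)) refl

  square-step : ∀ a η → ((a + η) * (a + η) + η * η) + ((a + η) * η + (a + η) * η)
                      ≡ (a + (η + η)) * (a + (η + η))
  square-step = solve 2 (λ a η →
    ((a :+ η) :* (a :+ η) :+ η :* η) :+ ((a :+ η) :* η :+ (a :+ η) :* η)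
    := (a :+ (η :+ η)) :* (a :+ (η :+ η))) refl

  *-pos : ∀ {p q} → 0ℚ < p → 0ℚ < q → 0ℚ < p * q
  *-pos {p} {q} 0<p 0<q =
    subst (_< p * q) (ℚ.*-zeroʳ p) (ℚ.*-monoʳ-<-pos p {{positive 0<p}} 0<q)

  *-nonNeg : ∀ {p q} → 0ℚ ≤ p → 0ℚ ≤ q → 0ℚ ≤ p * q
  *-nonNeg {p} {q} 0≤p 0≤q =
    subst (_≤ p * q) (ℚ.*-zeroʳ p) (ℚ.*-monoˡ-≤-nonNeg p {{nonNegative 0≤p}} 0≤q)

  *-mono-≤ : ∀ {p q r s} → 0ℚ ≤ r → 0ℚ ≤ q → p ≤ q → r ≤ s → p * r ≤ q * s
  *-mono-≤ {p} {q} {r} {s} 0≤r 0≤q p≤q r≤s = ℚ.≤-trans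
    (ℚ.*-monoʳ-≤-nonNeg r {{nonNegative 0≤r}} p≤q)
    (ℚ.*-monoˡ-≤-nonNeg q {{nonNegative 0≤q}} r≤s)

  *-mono-<-≤ : ∀ {p q r s} → 0ℚ ≤ r → 0ℚ < q → p ≤ q → r < s → p * r < q * s
  *-mono-<-≤ {p} {q} {r} {s} 0≤r 0<q p≤q r<s = ℚ.≤-<-trans
    (ℚ.*-monoʳ-≤-nonNeg r {{nonNegative 0≤r}} p≤q)
    (ℚ.*-monoʳ-<-pos q {{positive 0<q}} r<s)

  1/-pos : ∀ q (0<q : 0ℚ < q) → ∃[ r ] (0ℚ < r × r * q ≡ 1ℚ)
  1/-pos q 0<q =
    (1/ q) , ℚ.positive⁻¹ (1/ q) {{ℚ.1/pos⇒pos q {{pos}}}} , ℚ.*-inverseˡ q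
    where
    pos : Positive q
    pos = positive 0<q
    instance _ = ℚ.pos⇒nonZero q {{pos}}

  divide-pos : ∀ p q → 0ℚ < p → 0ℚ < q → ∃[ r ] (0ℚ < r × r * q ≡ p)
  divide-pos p q 0<p 0<q with 1/-pos q 0<q
  ... | r , 0<r , rq≡1 = p * r , *-pos 0<p 0<r ,
    trans (ℚ.*-assoc p r q) (trans (cong (p *_) rq≡1) (ℚ.*-identityʳ p))

  p≤∣p∣ : ∀ p → p ≤ ∣ p ∣
  p≤∣p∣ p with ℚ.≤-total 0ℚ p
  ... | inj₁ 0≤p = ℚ.≤-reflexive (sym (ℚ.0≤p⇒∣p∣≡p 0≤p))
  ... | inj₂ p≤0 = ℚ.≤-trans p≤0 (ℚ.0≤∣p∣ p)

  ∣p-q∣≡∣q-p∣ : ∀ p q → ∣ p - q ∣ ≡ ∣ q - p ∣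
  ∣p-q∣≡∣q-p∣ p q = trans
    (cong ∣_∣ (neg-flip p q)) (ℚ.∣-p∣≡∣p∣ (q - p))

  dist⇒< : ∀ p q {ε} → ∣ p - q ∣ < ε → p < q + ε
  dist⇒< p q {ε} d = subst (_< q + ε)
    (p+[q-p] q p)
    (ℚ.+-monoʳ-< q (ℚ.≤-<-trans (p≤∣p∣ (p - q)) d))

  <⇒dist : ∀ p q {ε} → p < q + ε → q < p + ε → ∣ p - q ∣ < ε
  <⇒dist p q {ε} p<q+ε q<p+ε with ℚ.∣p∣≡p∨∣p∣≡-p (p - q)
  ... | inj₁ e = subst₂ _<_ (sym e)
    ([p+q]-p q ε) (ℚ.+-monoˡ-< (- q) p<q+ε)
  ... | inj₂ e = subst₂ _<_
    (trans (neg-flip q p) (sym e))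
    ([p+q]-p p ε) (ℚ.+-monoˡ-< (- p) q<p+ε)

  ∣∣-+-< : ∀ p q {δ δ′} → ∣ p ∣ < δ → ∣ q ∣ < δ′ → ∣ p + q ∣ < δ + δ′
  ∣∣-+-< p q a b = ℚ.≤-<-trans (ℚ.∣p+q∣≤∣p∣+∣q∣ p q) (ℚ.+-mono-< a b)

  ∣∣-*-< : ∀ p q {δ B} → ∣ p ∣ < δ → ∣ q ∣ < B → 0ℚ < δ → ∣ p * q ∣ < δ * B
  ∣∣-*-< p q {δ} {B} a b 0<δ = subst (_< δ * B) (sym (ℚ.∣p*q∣≡∣p∣*∣q∣ p q))
    (*-mono-<-≤ (ℚ.0≤∣p∣ q) 0<δ (ℚ.<⇒≤ a) b)

  0<1 : 0ℚ < 1ℚ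
  0<1 = ℚ.positive⁻¹ 1ℚ

  p<p+1 : ∀ p → p < p + 1ℚ
  p<p+1 p = subst (_< p + 1ℚ) (ℚ.+-identityʳ p) (ℚ.+-monoʳ-< p 0<1)

  bounded : ∀ {s} → Cauchy s → ∃[ B ] (0ℚ < B × ∃[ N ] ∀ n → N ℕ.≤ n → ∣ s n ∣ < B)
  bounded {s} c with c 1ℚ 0<1
  ... | N , close = ∣ s N ∣ + 1ℚ , ℚ.≤-<-trans (ℚ.0≤∣p∣ (s N)) (p<p+1 ∣ s N ∣) , N , bound
    where
    bound : ∀ n → N ℕ.≤ n → ∣ s n ∣ < ∣ s N ∣ + 1ℚ
    bound n N≤n = subst₂ _<_
      (cong ∣_∣ ([q-p]+p (s N) (s n)))
      (ℚ.+-comm 1ℚ ∣ s N ∣)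
      (ℚ.≤-<-trans (ℚ.∣p+q∣≤∣p∣+∣q∣ (s n - s N) (s N))
        (ℚ.+-monoˡ-< ∣ s N ∣ (close n N N≤n ℕ.≤-refl)))

  cauchy-const : ∀ q → Cauchy (λ _ → q)
  cauchy-const q ε 0<ε = 0 , λ _ _ _ _ → subst (λ d → ∣ d ∣ < ε) (sym (ℚ.+-inverseʳ q)) 0<ε

  cauchy-+ : ∀ {s t} → Cauchy s → Cauchy t → Cauchy (λ n → s n + t n)
  cauchy-+ {s} {t} c d ε 0<ε with c (½ * ε) (half-pos 0<ε) | d (½ * ε) (half-pos 0<ε)
  ... | N , f | M , g = N ℕ.⊔ M , λ m n hm hn → subst₂ _<_
    (cong ∣_∣ (+-diff (s m) (t m) (s n) (t n)))
    (half+half ε)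
    (∣∣-+-< (s m - s n) (t m - t n)
      (f m n (⊔≤ˡ N M hm) (⊔≤ˡ N M hn))
      (g m n (⊔≤ʳ N M hm) (⊔≤ʳ N M hn)))

  cauchy-neg : ∀ {s} → Cauchy s → Cauchy (λ n → - s n)
  cauchy-neg {s} c ε 0<ε with c ε 0<ε
  ... | N , f = N , λ m n hm hn → subst (_< ε)
    (trans (∣p-q∣≡∣q-p∣ (s m) (s n))
      (cong ∣_∣ (neg-neg (s m) (s n))))
    (f m n hm hn)

  *-dist : ∀ a b c d {δ η B C} → 0ℚ < δ → 0ℚ < η →
           ∣ a - c ∣ < δ → ∣ b - d ∣ < η → ∣ b ∣ < C → ∣ c ∣ < B →
           ∣ a * b - c * d ∣ < δ * C + η * B
  *-dist a b c d {δ} {η} {B} {C} 0<δ 0<η a~c b~d b<C c<B =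
    subst (λ u → ∣ u ∣ < δ * C + η * B) (*-diff a b c d)
      (∣∣-+-< ((a - c) * b) ((b - d) * c)
        (∣∣-*-< (a - c) b a~c b<C 0<δ)
        (∣∣-*-< (b - d) c b~d c<B 0<η))

  cauchy-* : ∀ {s t} → Cauchy s → Cauchy t → Cauchy (λ n → s n * t n)
  cauchy-* {s} {t} c d ε 0<ε =
    let B , 0<B , N₁ , s<B = bounded {s} c
        C , 0<C , N₂ , t<C = bounded {t} d
        δ , 0<δ , δC = divide-pos (½ * ε) C (half-pos 0<ε) 0<C
        η , 0<η , ηB = divide-pos (½ * ε) B (half-pos 0<ε) 0<B
        N₃ , f = c δ 0<δ
        N₄ , g = d η 0<η
        N = (N₁ ℕ.⊔ N₂) ℕ.⊔ (N₃ ℕ.⊔ N₄)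
        first  = λ {k} (h : N ℕ.≤ k) → ⊔≤ˡ N₁ N₂ (⊔≤ˡ (N₁ ℕ.⊔ N₂) (N₃ ℕ.⊔ N₄) h)
        second = λ {k} (h : N ℕ.≤ k) → ⊔≤ʳ N₁ N₂ (⊔≤ˡ (N₁ ℕ.⊔ N₂) (N₃ ℕ.⊔ N₄) h)
        third  = λ {k} (h : N ℕ.≤ k) → ⊔≤ˡ N₃ N₄ (⊔≤ʳ (N₁ ℕ.⊔ N₂) (N₃ ℕ.⊔ N₄) h)
        fourth = λ {k} (h : N ℕ.≤ k) → ⊔≤ʳ N₃ N₄ (⊔≤ʳ (N₁ ℕ.⊔ N₂) (N₃ ℕ.⊔ N₄) h)
    in N , λ m n hm hn →
      subst (∣ s m * t m - s n * t n ∣ <_)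
        (trans (cong₂ _+_ δC ηB) (half+half ε))
        (*-dist (s m) (t m) (s n) (t n) 0<δ 0<η
          (f m n (third hm) (third hn)) (g m n (fourth hm) (fourth hn))
          (t<C m (second hm)) (s<B n (first hn)))

  recip-inverse : ∀ q → 0ℚ < ∣ q ∣ → q * recip q ≡ 1ℚ
  recip-inverse q 0<∣q∣ with q ℚ.≟ 0ℚ
  ... | yes refl = ⊥-elim (ℚ.<-irrefl refl 0<∣q∣)
  ... | no  q≢0  = ℚ.*-inverseʳ q {{ℚ.≢-nonZero q≢0}}

  recip-dist : ∀ a b {δ ε} → 0ℚ < δ → 0ℚ < ε → δ ≤ ∣ a ∣ → δ ≤ ∣ b ∣ →
               ∣ a - b ∣ < ε * (δ * δ) → ∣ recip a - recip b ∣ < ε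
  recip-dist a b {δ} {ε} 0<δ 0<ε δ≤a δ≤b a~b = ℚ.*-cancelʳ-<-nonNeg (∣ a ∣ * ∣ b ∣)
    {{nonNegative (*-nonNeg (ℚ.0≤∣p∣ a) (ℚ.0≤∣p∣ b))}} (ℚ.<-≤-trans small large)
    where
    clear : b - a ≡ (recip a - recip b) * (a * b)
    clear = trans
      (cong₂ (λ u v → u - v)
        (sym (trans (cong (b *_) (recip-inverse a (ℚ.<-≤-trans 0<δ δ≤a))) (ℚ.*-identityʳ b)))
        (sym (trans (cong (a *_) (recip-inverse b (ℚ.<-≤-trans 0<δ δ≤b))) (ℚ.*-identityʳ a))))
      (recip-diff a b (recip a) (recip b))
    small : ∣ recip a - recip b ∣ * (∣ a ∣ * ∣ b ∣) < ε * (δ * δ)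
    small = subst (_< ε * (δ * δ))
      (trans (∣p-q∣≡∣q-p∣ a b) (trans (cong ∣_∣ clear)
        (trans (ℚ.∣p*q∣≡∣p∣*∣q∣ (recip a - recip b) (a * b))
          (cong (∣ recip a - recip b ∣ *_) (ℚ.∣p*q∣≡∣p∣*∣q∣ a b)))))
      a~b
    large : ε * (δ * δ) ≤ ε * (∣ a ∣ * ∣ b ∣)
    large = ℚ.*-monoˡ-≤-nonNeg ε {{nonNegative (ℚ.<⇒≤ 0<ε)}}
      (*-mono-≤ (ℚ.<⇒≤ 0<δ) (ℚ.0≤∣p∣ a) δ≤a δ≤b)

  cauchy-recip : ∀ {s} → Cauchy s → ∀ δ → 0ℚ < δ → ∀ M → (∀ n → M ℕ.≤ n → δ ≤ ∣ s n ∣) →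
                 Cauchy (λ n → recip (s n))
  cauchy-recip {s} c δ 0<δ M away ε 0<ε =
    let N , f = c (ε * (δ * δ)) (*-pos 0<ε (*-pos 0<δ 0<δ))
    in M ℕ.⊔ N , λ m n hm hn → recip-dist (s m) (s n) 0<δ 0<ε
         (away m (⊔≤ˡ M N hm)) (away n (⊔≤ˡ M N hn)) (f m n (⊔≤ʳ M N hm) (⊔≤ʳ M N hn))

  fromℕ-ℚ-suc : ∀ n → fromℕ-ℚ (suc n) ≡ 1ℚ + fromℕ-ℚ n
  fromℕ-ℚ-suc n = ℚ.toℚᵘ-injective (ℚᵘ.≃-trans (ℚ.toℚᵘ-fromℚᵘ (ℚᵘ.mkℚᵘ (ℤ.+ suc n) 0))
    (ℚᵘ.≃-trans (ℚᵘ.*≡* eq)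
      (ℚᵘ.≃-sym (ℚᵘ.≃-trans (ℚ.toℚᵘ-homo-+ 1ℚ (fromℕ-ℚ n))
        (ℚᵘ.+-congʳ ℚᵘ.1ℚᵘ (ℚ.toℚᵘ-fromℚᵘ (ℚᵘ.mkℚᵘ (ℤ.+ n) 0)))))))
    where
    eq : (ℤ.+ suc n) ℤ.* ℤ.1ℤ ≡ (ℤ.1ℤ ℤ.+ (ℤ.+ n) ℤ.* ℤ.1ℤ) ℤ.* ℤ.1ℤ
    eq = cong (ℤ._* ℤ.1ℤ) (cong (λ z → ℤ.1ℤ ℤ.+ z) (sym (ℤ.*-identityʳ (ℤ.+ n))))

  fromℕ-ℚ-mono : ∀ {m n} → m ℕ.≤ n → fromℕ-ℚ m ≤ fromℕ-ℚ n
  fromℕ-ℚ-mono {m} {n} m≤n = ℚ.toℚᵘ-cancel-≤ (ℚᵘ.≤-respˡ-≃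
    (ℚᵘ.≃-sym (ℚ.toℚᵘ-fromℚᵘ (ℚᵘ.mkℚᵘ (ℤ.+ m) 0)))
    (ℚᵘ.≤-respʳ-≃ (ℚᵘ.≃-sym (ℚ.toℚᵘ-fromℚᵘ (ℚᵘ.mkℚᵘ (ℤ.+ n) 0)))
      (ℚᵘ.*≤* (ℤ.*-monoʳ-≤-nonNeg ℤ.1ℤ (ℤ.+≤+ m≤n)))))

  ½^-pos : ∀ n → 0ℚ < ½^ n
  ½^-pos zero    = 0<1
  ½^-pos (suc n) = half-pos (½^-pos n)

  ½^≤1 : ∀ n → ½^ n ≤ 1ℚ
  ½^≤1 zero    = ℚ.≤-refl
  ½^≤1 (suc n) = ℚ.≤-trans (ℚ.*-monoˡ-≤-nonNeg ½ (½^≤1 n))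
    (ℚ.<⇒≤ (ℚ.*<* (ℤ.+<+ (ℕ.s≤s (ℕ.s≤s ℕ.z≤n)))))

  ½^-bound : ∀ n → ½^ n * fromℕ-ℚ (suc n) ≤ 1ℚ
  ½^-bound zero    = ℚ.≤-refl
  ½^-bound (suc n) = subst (_≤ 1ℚ)
    (trans (half-step (½^ n) (fromℕ-ℚ (suc n))) (cong (½^ (suc n) *_) (sym (fromℕ-ℚ-suc (suc n)))))
    (ℚ.+-mono-≤ (ℚ.*-monoˡ-≤-nonNeg ½ (½^-bound n)) (ℚ.*-monoˡ-≤-nonNeg ½ (½^≤1 n)))

  archimedean : ∀ q → ∃[ n ] q ≤ fromℕ-ℚ n
  archimedean q@(ℚ.mkℚ n d-1 _) = ℤ.∣ n ∣ , ℚ.toℚᵘ-cancel-≤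
    (ℚᵘ.≤-respʳ-≃ (ℚᵘ.≃-sym (ℚ.toℚᵘ-fromℚᵘ (ℚᵘ.mkℚᵘ (ℤ.+ ℤ.∣ n ∣) 0))) (ℚᵘ.*≤* (le n)))
    where
    le : ∀ n → n ℤ.* ℤ.1ℤ ℤ.≤ ℤ.+ ℤ.∣ n ∣ ℤ.* ℤ.+ suc d-1
    le n = subst (ℤ._≤ ℤ.+ ℤ.∣ n ∣ ℤ.* ℤ.+ suc d-1) (sym (ℤ.*-identityʳ n))
      (ℤ.≤-trans (below n) (subst (ℤ.+ ℤ.∣ n ∣ ℤ.≤_) (ℤ.pos-* ℤ.∣ n ∣ (suc d-1))
        (ℤ.+≤+ (ℕ.m≤m*n ℤ.∣ n ∣ (suc d-1)))))
      where
      below : ∀ n → n ℤ.≤ ℤ.+ ℤ.∣ n ∣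
      below (ℤ.+ n)      = ℤ.≤-refl
      below ℤ.-[1+ n ] = ℤ.-≤+

  ½^-small : ∀ δ → 0ℚ < δ → ∃[ N ] ∀ n → N ℕ.≤ n → ½^ n < δ
  ½^-small δ 0<δ with 1/-pos δ 0<δ
  ... | r , 0<r , rδ with archimedean r
  ... | N , r≤N = N , small
    where
    small : ∀ n → N ℕ.≤ n → ½^ n < δ
    small n N≤n = ℚ.*-cancelʳ-<-nonNeg k {{nonNegative (ℚ.≤-trans (ℚ.<⇒≤ 0<r) (ℚ.<⇒≤ r<k))}}
      (ℚ.≤-<-trans (½^-bound n) (subst (_< δ * k) (trans (ℚ.*-comm δ r) rδ)
        (ℚ.*-monoʳ-<-pos δ {{positive 0<δ}} r<k)))
      where
      k : ℚ
      k = fromℕ-ℚ (suc n)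
      r<k : r < k
      r<k = ℚ.≤-<-trans (ℚ.≤-trans r≤N (fromℕ-ℚ-mono N≤n))
        (subst (fromℕ-ℚ n <_) (trans (ℚ.+-comm (fromℕ-ℚ n) 1ℚ) (sym (fromℕ-ℚ-suc n)))
          (p<p+1 (fromℕ-ℚ n)))

  module _ (q : ℚ) (0≤q : 0ℚ ≤ q) where

    0<q+1 : 0ℚ < q + 1ℚ
    0<q+1 = ℚ.≤-<-trans 0≤q (p<p+1 q)

    width-pos : ∀ n → 0ℚ < width q n
    width-pos n = *-pos 0<q+1 (½^-pos n)

    width-halves : ∀ n → width q (suc n) + width q (suc n) ≡ width q n
    width-halves n = halves (q + 1ℚ) (½^ n)

    lower-nonNeg : ∀ n → 0ℚ ≤ lower q n
    lower-nonNeg zero    = ℚ.≤-refl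
    lower-nonNeg (suc n)
      with (lower q n + width q (suc n)) * (lower q n + width q (suc n)) ℚ.≤? q
    ... | yes _ = ℚ.+-mono-≤ (lower-nonNeg n) (ℚ.<⇒≤ (width-pos (suc n)))
    ... | no  _ = lower-nonNeg n

    lower² : ∀ n → lower q n * lower q n ≤ q
    lower² zero    = 0≤q
    lower² (suc n)
      with (lower q n + width q (suc n)) * (lower q n + width q (suc n)) ℚ.≤? q
    ... | yes p = p
    ... | no  _ = lower² n

    upper² : ∀ n → q < (lower q n + width q n) * (lower q n + width q n)
    upper² zero = subst (q <_)
      ([q+1]² q)
      (ℚ.<-≤-trans (p<p+1 q) (subst (_≤ (q + 1ℚ) + (q * q + q)) (ℚ.+-identityʳ (q + 1ℚ))
        (ℚ.+-monoʳ-≤ (q + 1ℚ) (ℚ.+-mono-≤ (*-nonNeg 0≤q 0≤q) 0≤q))))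
    upper² (suc n)
      with (lower q n + width q (suc n)) * (lower q n + width q (suc n)) ℚ.≤? q
    ... | no ¬p = ℚ.≰⇒> ¬p
    ... | yes _ = subst (λ u → q < u * u)
      (trans (cong (lower q n +_) (sym (width-halves n)))
        (sym (ℚ.+-assoc (lower q n) (width q (suc n)) (width q (suc n)))))
      (upper² n)

  clip-dist : ∀ p q {δ} → 0ℚ < δ → ∣ p - q ∣ < δ → 0ℚ ⊔ p < (0ℚ ⊔ q) + δ
  clip-dist p q {δ} 0<δ d with ℚ.⊔-sel 0ℚ p
  ... | inj₁ e = subst (_< (0ℚ ⊔ q) + δ) (sym e) (ℚ.+-mono-≤-< (ℚ.p≤p⊔q 0ℚ q) 0<δ)
  ... | inj₂ e = subst (_< (0ℚ ⊔ q) + δ) (sym e)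
    (ℚ.<-≤-trans (dist⇒< p q d) (ℚ.+-monoˡ-≤ δ (ℚ.p≤q⊔p 0ℚ q)))

  width-small : ∀ {s} → Cauchy s → ∀ ε → 0ℚ < ε →
                ∃[ N ] ∀ n → N ℕ.≤ n → width (0ℚ ⊔ s n) n < ε
  width-small {s} c ε 0<ε =
    let B , 0<B , N , s<B = bounded {s} c
        0<B+1 = ℚ.<-trans 0<B (p<p+1 B)
        δ , 0<δ , δ[B+1] = divide-pos ε (B + 1ℚ) 0<ε 0<B+1
        M , small = ½^-small δ 0<δ
    in N ℕ.⊔ M , λ n h → subst (width (0ℚ ⊔ s n) n <_)
      (trans (ℚ.*-comm (B + 1ℚ) δ) δ[B+1])
      (*-mono-<-≤ (ℚ.<⇒≤ (½^-pos n)) 0<B+1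
        (ℚ.+-monoˡ-≤ 1ℚ (ℚ.⊔-lub (ℚ.<⇒≤ 0<B)
          (ℚ.≤-trans (p≤∣p∣ (s n)) (ℚ.<⇒≤ (s<B n (⊔≤ˡ N M h))))))
        (small n (⊔≤ʳ N M h)))

  -- If a ≤ √u and √v < b + η, where η = ε / 2, then u < v + η² forces a < b + ε.
  root-bound : ∀ {u v a b w} ε → 0ℚ < ε → 0ℚ ≤ a → 0ℚ ≤ b → 0ℚ ≤ w → w ≤ ½ * ε →
               a * a ≤ u → v < (b + w) * (b + w) → u < v + (½ * ε) * (½ * ε) → a < b + ε
  root-bound {u} {v} {a} {b} {w} ε 0<ε 0≤a 0≤b 0≤w w≤η a²≤u v<b+w² u<v+η² =
    decidable-stable (a ℚ.<? b + ε) λ a≮b+ε →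
      ℚ.<-irrefl refl (ℚ.<-≤-trans far (near (ℚ.≮⇒≥ a≮b+ε)))
    where
    η : ℚ
    η = ½ * ε
    0≤η : 0ℚ ≤ η
    0≤η = ℚ.<⇒≤ (half-pos 0<ε)
    0≤b+η : 0ℚ ≤ b + η
    0≤b+η = ℚ.+-mono-≤ 0≤b 0≤η
    far : u < (b + η) * (b + η) + η * η
    far = ℚ.<-≤-trans u<v+η² (ℚ.+-monoˡ-≤ (η * η) (ℚ.≤-trans (ℚ.<⇒≤ v<b+w²)
      (*-mono-≤ (ℚ.+-mono-≤ 0≤b 0≤w) 0≤b+η (ℚ.+-monoʳ-≤ b w≤η) (ℚ.+-monoʳ-≤ b w≤η))))
    cross : (b + η) * (b + η) + η * η ≤ (b + ε) * (b + ε)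
    cross = subst₂ _≤_ (ℚ.+-identityʳ ((b + η) * (b + η) + η * η))
      (trans (square-step b η) (cong (λ e → (b + e) * (b + e)) (half+half ε)))
      (ℚ.+-monoʳ-≤ ((b + η) * (b + η) + η * η)
        (ℚ.+-mono-≤ (*-nonNeg 0≤b+η 0≤η) (*-nonNeg 0≤b+η 0≤η)))
    near : b + ε ≤ a → (b + η) * (b + η) + η * η ≤ u
    near b+ε≤a = ℚ.≤-trans cross (ℚ.≤-trans
      (*-mono-≤ (ℚ.+-mono-≤ 0≤b (ℚ.<⇒≤ 0<ε)) 0≤a b+ε≤a b+ε≤a) a²≤u)

  cauchy-√ : ∀ {s} → Cauchy s → Cauchy (λ n → lower (0ℚ ⊔ s n) n)
  cauchy-√ {s} c ε 0<ε =
    let N , narrow = width-small {s} c (½ * ε) (half-pos 0<ε)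
        M , close  = c ((½ * ε) * (½ * ε)) 0<η²
        bound : ∀ m n → N ℕ.⊔ M ℕ.≤ m → N ℕ.⊔ M ℕ.≤ n → root m < root n + ε
        bound m n hm hn = root-bound {clip m} {clip n} {root m} {root n} ε 0<ε (0≤root m) (0≤root n)
          (ℚ.<⇒≤ (width-pos (clip n) (0≤clip n) n))
          (ℚ.<⇒≤ (narrow n (⊔≤ˡ N M hn)))
          (lower² (clip m) (0≤clip m) m)
          (upper² (clip n) (0≤clip n) n)
          (clip-dist (s m) (s n) 0<η² (close m n (⊔≤ʳ N M hm) (⊔≤ʳ N M hn)))
    in N ℕ.⊔ M , λ m n hm hn →
      <⇒dist (root m) (root n) (bound m n hm hn) (bound n m hn hm)
    where
    0<η² : 0ℚ < (½ * ε) * (½ * ε)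
    0<η² = *-pos (half-pos 0<ε) (half-pos 0<ε)
    clip root : ℕ → ℚ
    clip n = 0ℚ ⊔ s n
    root n = lower (clip n) n
    0≤clip : ∀ n → 0ℚ ≤ clip n
    0≤clip n = ℚ.p≤p⊔q 0ℚ (s n)
    0≤root : ∀ n → 0ℚ ≤ root n
    0≤root n = lower-nonNeg (clip n) (0≤clip n) n

record ℝ : Set where
  constructor mkℝ
  field
    seq    : ℕ → ℚ
    cauchy : Cauchy seq

open ℝ public

infix  4 _≃_ _#_
infixl 6 _+_ _-_
infixl 7 _*_
infix  8 -_ √_

_≃_ : Rel ℝ 0ℓ
x ≃ y = ∀ ε → 0ℚ ℚ.< ε → ∃[ N ] ∀ n → N ℕ.≤ n → ℚ.∣ seq x n ℚ.- seq y n ∣ ℚ.< ε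

_#_ : Rel ℝ 0ℓ
x # y = ∃[ δ ] (0ℚ ℚ.< δ × ∃[ N ] ∀ n → N ℕ.≤ n → δ ℚ.≤ ℚ.∣ seq x n ℚ.- seq y n ∣)

fromℚ : ℚ → ℝ
fromℚ q = mkℝ (λ _ → q) (cauchy-const q)

fromℕ : ℕ → ℝ
fromℕ n = fromℚ (fromℕ-ℚ n)

0ℝ 1ℝ 2ℝ 4ℝ : ℝ
0ℝ = fromℕ 0
1ℝ = fromℕ 1
2ℝ = fromℕ 2
4ℝ = fromℕ 4

_+_ _*_ : ℝ → ℝ → ℝ
x + y = mkℝ (λ n → seq x n ℚ.+ seq y n) (cauchy-+ {seq x} {seq y} (cauchy x) (cauchy y))
x * y = mkℝ (λ n → seq x n ℚ.* seq y n) (cauchy-* {seq x} {seq y} (cauchy x) (cauchy y))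

-_ : ℝ → ℝ
- x = mkℝ (λ n → ℚ.- seq x n) (cauchy-neg {seq x} (cauchy x))

_-_ : ℝ → ℝ → ℝ
x - y = x + (- y)

-- The square root of the positive part of x.
√_ : ℝ → ℝ
√ x = mkℝ (λ n → lower (0ℚ ℚ.⊔ seq x n) n) (cauchy-√ {seq x} (cauchy x))

inverse : (x : ℝ) → x # 0ℝ → ℝ
inverse x (δ , 0<δ , N , away) = mkℝ (λ n → recip (seq x n))
  (cauchy-recip {seq x} (cauchy x) δ 0<δ N λ n h →
    subst (λ q → δ ℚ.≤ ℚ.∣ q ∣) (ℚ.+-identityʳ (seq x n)) (away n h))

divide : (x y : ℝ) → y # 0ℝ → ℝ
divide x y y#0 = x * inverse y y#0

infixl 7 divide
syntax divide x y y#0 = x ÷ y [ y#0 ]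

2#0 : 2ℝ # 0ℝ
2#0 = 1ℚ , 0<1 , 0 , λ _ _ → ℚ.≤ᵇ⇒≤ _

ℝ-rawRing : RawRing 0ℓ 0ℓ
ℝ-rawRing = record
  { Carrier = ℝ ; _≈_ = _≃_ ; _+_ = _+_ ; _*_ = _*_ ; -_ = -_ ; 0# = 0ℝ ; 1# = 1ℝ }

open import Algebra.Definitions.RawSemiring (RawRing.rawSemiring ℝ-rawRing) public using (_^_)

{-# OPTIONS --safe #-}
-- Let p(n) count the colourings of the path on n vertices and fix a colour c.  If c ≤ y,
-- the colourings starting with c on n + 2 and on n + 1 vertices together number p(n+1):
-- deleting the first vertex of the former misses exactly the latter.  If c > y, then c
-- extends every colouring and the two numbers are p(n+1) and p(n).  Summing over c gives
--   p(n+2) = (x − 1) p(n+1) + (x − y) p(n),  p(0) = 1,  p(1) = x.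
-- The roots of the characteristic polynomial are (x − 1 ± s) / 2 with
-- s² = (x + 1)² − 4 y, so the closed form obeys the same recurrence and initial values.
module Submission where

open import Defs
open import Data.Bool.Base using (true; false; if_then_else_)
open import Data.Empty using (⊥-elim)
open import Data.Fin.Base using (Fin; zero; suc; punchIn)
import Data.Fin.Properties as Fin
open import Data.List.Base using (length; filter; map; tabulate; cartesianProductWith; _∷_; [])
open import Data.List.Properties using (filter-≐; filter-none; filter-accept; filter-++; length-++)
import Data.List.Relation.Unary.All as All
open import Data.Nat.Base as ℕ using (ℕ; zero; suc; _≤_)
import Data.Nat.Properties as ℕ
import Data.Nat.Solver
open import Data.Product.Base using (Σ-syntax; ∃-syntax; _×_; _,_; proj₁; proj₂)
open import Algebra.Properties.CommutativeMonoid.Sum ℕ.+-0-commutativeMonoid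
  using (sum; sum-cong-≗; sum-remove; ∑-distrib-+)
open import Data.Rational as ℚ using (ℚ; 0ℚ; 1ℚ; ½)
import Data.Rational.Properties as ℚ
import Data.Rational.Solver
open import Data.Sum.Base as Sum using (_⊎_; inj₁; inj₂)
open import Data.Vec.Base using (Vec; _∷_; [])
open import Function.Base using (_∘_; id)
open import Level using (0ℓ)
open import Relation.Binary.Bundles using (Setoid)
open import Relation.Binary.PropositionalEquality
  using (_≡_; _≢_; refl; sym; trans; cong; cong₂; subst; subst₂; module ≡-Reasoning)
import Relation.Binary.Reasoning.Setoid
open import Relation.Nullary using (¬_; Dec; yes; no; does)
open import Relation.Nullary.Decidable using (decidable-stable)
open import Relation.Unary as U using (Pred)

-- Counting colourings of paths

Compatible : ∀ {x} → ℕ → Fin x → Fin x → Set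
Compatible y c d = c ≢ d ⊎ (c ≡ d × y ℕ.< colour c)

compatible-sym : ∀ {x y} {c d : Fin x} → Compatible y c d → Compatible y d c
compatible-sym (inj₁ c≢d)        = inj₁ (c≢d ∘ sym)
compatible-sym (inj₂ (refl , p)) = inj₂ (refl , p)

high-compatible : ∀ {x y} {c : Fin x} → y ℕ.< colour c → ∀ d → Compatible y c d
high-compatible {c = c} y<c d with c Fin.≟ d
... | yes c≡d = inj₂ (c≡d , y<c)
... | no  c≢d = inj₁ c≢d

Colouring : ∀ x y {n} → Vec (Fin x) n → Set
Colouring x y {n} = IsColouring (path n) x y

colouring? : ∀ x y {n} → U.Decidable (Colouring x y {n})
colouring? x y {n} = isColouring? (path n) x y

module _ {x y : ℕ} where

  colouring-tail : ∀ {n} {c : Fin x} {f : Vec (Fin x) n} → Colouring x y (c ∷ f) → Colouring x y f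
  colouring-tail h v w e = h (suc v) (suc w) (Sum.map (cong suc) (cong suc) e)

  colouring-head : ∀ {n} {c d : Fin x} {f : Vec (Fin x) n} →
                   Colouring x y (c ∷ d ∷ f) → Compatible y c d
  colouring-head h = h zero (suc zero) (inj₁ refl)

  colouring-[_] : ∀ (c : Fin x) → Colouring x y (c ∷ [])
  colouring-[ c ] zero zero (inj₁ ())
  colouring-[ c ] zero zero (inj₂ ())

  -- Vertex 0 is adjacent to vertex 1 only, so `p` settles all edges at it; every other edge is an
  -- edge of the shorter path with both ends shifted by one.
  colouring-∷ : ∀ {n} {c d : Fin x} {f : Vec (Fin x) n} →
                Compatible y c d → Colouring x y (d ∷ f) → Colouring x y (c ∷ d ∷ f)
  colouring-∷ p h zero          zero          (inj₁ ())
  colouring-∷ p h zero          zero          (inj₂ ())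
  colouring-∷ p h zero          (suc zero)    e         = p
  colouring-∷ p h zero          (suc (suc w)) (inj₁ ())
  colouring-∷ p h zero          (suc (suc w)) (inj₂ ())
  colouring-∷ p h (suc zero)    zero          e         = compatible-sym p
  colouring-∷ p h (suc (suc v)) zero          (inj₁ ())
  colouring-∷ p h (suc (suc v)) zero          (inj₂ ())
  colouring-∷ p h (suc v)       (suc w)       e         =
    h v w (Sum.map ℕ.suc-injective ℕ.suc-injective e)

  colouring-high-∷ : ∀ {n} {c : Fin x} → y ℕ.< colour c →
                     (f : Vec (Fin x) n) → Colouring x y f → Colouring x y (c ∷ f)
  colouring-high-∷ {c = c} y<c []      h = colouring-[ c ]
  colouring-high-∷         y<c (d ∷ f) h = colouring-∷ (high-compatible y<c d) h

-- Counts over lists and sums over `Fin`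

module _ {a p} {A : Set a} {P : Pred A p} (P? : U.Decidable P) where

  length-filter-map : ∀ {b} {B : Set b} (f : B → A) xs →
    length (filter P? (map f xs)) ≡ length (filter (P? ∘ f) xs)
  length-filter-map f [] = refl
  length-filter-map f (x ∷ xs) with does (P? (f x))
  ... | true  = cong suc (length-filter-map f xs)
  ... | false = length-filter-map f xs

  -- Splits a count over `allMaps (suc n) x` by the first entry. `allFin` is generalised to
  -- `tabulate g` so that the induction can pass to `g ∘ suc`.
  length-filter-cartesianProductWith :
    ∀ {b c} {B : Set b} {C : Set c} (f : B → C → A) {n} (g : Fin n → B) ys →
    length (filter P? (cartesianProductWith f (tabulate g) ys)) ≡
    sum (λ i → length (filter (P? ∘ f (g i)) ys))
  length-filter-cartesianProductWith f {zero}  g ys = refl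
  length-filter-cartesianProductWith f {suc n} g ys = trans
    (cong length (filter-++ P? (map (f (g zero)) ys) _))
    (trans (length-++ (filter P? (map (f (g zero)) ys)))
      (cong₂ ℕ._+_ (length-filter-map (f (g zero)) ys)
        (length-filter-cartesianProductWith f (g ∘ suc) ys)))

-- Phrased with `does P?` because `does (y ℕ.<? colour c)` computes to `y ℕ.<ᵇ colour c`, the test
-- inside the sum of `sum-threshold`.
if-intro : ∀ {p a} {P : Set p} {A : Set a} {z t e : A} (P? : Dec P) →
           (P → z ≡ t) → (¬ P → z ≡ e) → z ≡ (if does P? then t else e)
if-intro (yes p) f g = f p
if-intro (no ¬p) f g = g ¬p

sum-const : ∀ n k → sum {n} (λ _ → k) ≡ n ℕ.* k
sum-const zero    k = refl
sum-const (suc n) k = cong (k ℕ.+_) (sum-const n k)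

-- The first `y` colours get `l` and the other `x − y` get `h`; the summand `y * h` on the left
-- avoids truncated subtraction. The induction removes colour 1, which is low, and the threshold
-- drops with the remaining colours.
sum-threshold : ∀ {x y} → y ℕ.≤ x → ∀ h l →
  sum {x} (λ c → if y ℕ.<ᵇ colour c then h else l) ℕ.+ y ℕ.* h ≡ x ℕ.* h ℕ.+ y ℕ.* l
sum-threshold {x} {zero} ℕ.z≤n h l = cong (ℕ._+ 0) (sum-const x h)
sum-threshold {suc x} {suc y} (ℕ.s≤s y≤x) h l = begin
  (l ℕ.+ s) ℕ.+ (h ℕ.+ y ℕ.* h)        ≡⟨ solve 4 (λ l s h yh → (l :+ s) :+ (h :+ yh) := (h :+ l) :+ (s :+ yh)) refl l s h (y ℕ.* h) ⟩
  (h ℕ.+ l) ℕ.+ (s ℕ.+ y ℕ.* h)        ≡⟨ cong (h ℕ.+ l ℕ.+_) (sum-threshold y≤x h l) ⟩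
  (h ℕ.+ l) ℕ.+ (x ℕ.* h ℕ.+ y ℕ.* l)  ≡⟨ solve 4 (λ l h xh yl → (h :+ l) :+ (xh :+ yl) := (h :+ xh) :+ (l :+ yl)) refl l h (x ℕ.* h) (y ℕ.* l) ⟩
  (h ℕ.+ x ℕ.* h) ℕ.+ (l ℕ.+ y ℕ.* l)  ∎
  where
  open ≡-Reasoning
  open Data.Nat.Solver.+-*-Solver
  s = sum {x} (λ c → if y ℕ.<ᵇ colour c then h else l)

sum-change-at : ∀ {n} (i : Fin n) (s t : Fin n → ℕ) → s i ≡ 0 →
  (∀ j → i ≢ j → s j ≡ t j) → sum s ℕ.+ t i ≡ sum t
sum-change-at {suc n} i s t sᵢ≡0 s≡t = begin
  sum s ℕ.+ t i                          ≡⟨ cong (ℕ._+ t i) (sum-remove {i = i} s) ⟩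
  (s i ℕ.+ sum (s ∘ punchIn i)) ℕ.+ t i  ≡⟨ cong (λ u → (u ℕ.+ sum (s ∘ punchIn i)) ℕ.+ t i) sᵢ≡0 ⟩
  sum (s ∘ punchIn i) ℕ.+ t i            ≡⟨ cong (ℕ._+ t i) (sum-cong-≗ λ j → s≡t (punchIn i j) (Fin.punchInᵢ≢i i j ∘ sym)) ⟩
  sum (t ∘ punchIn i) ℕ.+ t i            ≡⟨ ℕ.+-comm _ (t i) ⟩
  t i ℕ.+ sum (t ∘ punchIn i)            ≡⟨ sum-remove {i = i} t ⟨
  sum t                                  ∎
  where open ≡-Reasoning

-- The recurrence for path colourings

module _ (x y : ℕ) where

  -- Here `n` is the number of vertices after the first, so the colourings counted live on
  -- `path (suc n)`.
  extensions : ∀ n → Fin x → ℕ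
  extensions n c = length (filter (λ f → colouring? x y (c ∷ f)) (allMaps n x))

  pathCount-suc : ∀ n → P (path (suc n)) x y ≡ sum (extensions n)
  pathCount-suc n = length-filter-cartesianProductWith (colouring? x y) _∷_ id (allMaps n x)

  extensions-high : ∀ n {c} → y ℕ.< colour c → extensions n c ≡ P (path n) x y
  extensions-high n {c} y<c = cong length (filter-≐ (λ f → colouring? x y (c ∷ f)) (colouring? x y)
    (colouring-tail , λ {f} → colouring-high-∷ y<c f) (allMaps n x))

  -- Sort by the second colour `d`. The choice `d = c` is impossible for a low `c`; for any other
  -- `d` the new first edge is satisfied, so prefixing `c` adds no constraint. The sum over `d` thus
  -- misses exactly the term at `c`.
  extensions-low : ∀ n {c} → ¬ (y ℕ.< colour c) → extensions (suc n) c ℕ.+ extensions n c ≡ P (path (suc n)) x y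
  extensions-low n {c} y≮c = begin
    extensions (suc n) c ℕ.+ extensions n c
      ≡⟨ cong (ℕ._+ extensions n c)
           (length-filter-cartesianProductWith (λ f → colouring? x y (c ∷ f)) _∷_ id (allMaps n x)) ⟩
    sum next ℕ.+ extensions n c
      ≡⟨ sum-change-at c next (extensions n) repeated distinct ⟩
    sum (extensions n)
      ≡⟨ pathCount-suc n ⟨
    P (path (suc n)) x y ∎
    where
    open ≡-Reasoning
    next : Fin x → ℕ
    next d = length (filter (λ f → colouring? x y (c ∷ d ∷ f)) (allMaps n x))
    incompatible : ¬ Compatible y c c
    incompatible (inj₁ c≢c)       = c≢c refl
    incompatible (inj₂ (_ , y<c)) = y≮c y<c
    repeated : next c ≡ 0
    repeated = cong length (filter-none (λ f → colouring? x y (c ∷ c ∷ f))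
      (All.universal (λ f h → incompatible (colouring-head h)) (allMaps n x)))
    distinct : ∀ d → c ≢ d → next d ≡ extensions n d
    distinct d c≢d = cong length (filter-≐ (λ f → colouring? x y (c ∷ d ∷ f)) (λ f → colouring? x y (d ∷ f))
      (colouring-tail , colouring-∷ (inj₁ c≢d)) (allMaps n x))

  extensions-sum : ∀ n c → extensions (suc n) c ℕ.+ extensions n c ≡
    (if y ℕ.<ᵇ colour c then P (path (suc n)) x y ℕ.+ P (path n) x y else P (path (suc n)) x y)
  extensions-sum n c = if-intro (y ℕ.<? colour c)
    (λ y<c → cong₂ ℕ._+_ (extensions-high (suc n) y<c) (extensions-high n y<c))
    (extensions-low n)

  pathCount-zero : P (path 0) x y ≡ 1
  pathCount-zero = cong length (filter-accept (colouring? x y) {x = []} {xs = []} λ ())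

  pathCount-one : P (path 1) x y ≡ x
  pathCount-one = begin
    P (path 1) x y      ≡⟨ pathCount-suc 0 ⟩
    sum (extensions 0)  ≡⟨ sum-cong-≗ (λ c → cong length
                               (filter-accept (λ f → colouring? x y (c ∷ f)) {xs = []} colouring-[ c ])) ⟩
    sum {x} (λ _ → 1)  ≡⟨ sum-const x 1 ⟩
    x ℕ.* 1            ≡⟨ ℕ.*-identityʳ x ⟩
    x                  ∎
    where open ≡-Reasoning

  pathCount-recurrence : y ℕ.≤ x → ∀ n →
    P (path (suc (suc n))) x y ℕ.+ P (path (suc n)) x y ℕ.+ y ℕ.* P (path n) x y ≡
    x ℕ.* P (path (suc n)) x y ℕ.+ x ℕ.* P (path n) x y
  -- With `h = p₁ + p₀` and `l = p₁`, `sum-threshold` leaves `y * p₁` on both sides.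
  pathCount-recurrence y≤x n = ℕ.+-cancelʳ-≡ (y ℕ.* p₁) _ _ (begin
    (p₂ ℕ.+ p₁ ℕ.+ y ℕ.* p₀) ℕ.+ y ℕ.* p₁
      ≡⟨ solve 5 (λ p₂ p₁ p₀ y x → (p₂ :+ p₁ :+ y :* p₀) :+ y :* p₁ := (p₂ :+ p₁) :+ y :* (p₁ :+ p₀)) refl p₂ p₁ p₀ y x ⟩
    (p₂ ℕ.+ p₁) ℕ.+ y ℕ.* (p₁ ℕ.+ p₀)
      ≡⟨ cong (ℕ._+ y ℕ.* (p₁ ℕ.+ p₀)) total ⟩
    sum {x} (λ c → if y ℕ.<ᵇ colour c then p₁ ℕ.+ p₀ else p₁) ℕ.+ y ℕ.* (p₁ ℕ.+ p₀)
      ≡⟨ sum-threshold y≤x (p₁ ℕ.+ p₀) p₁ ⟩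
    x ℕ.* (p₁ ℕ.+ p₀) ℕ.+ y ℕ.* p₁
      ≡⟨ cong (ℕ._+ y ℕ.* p₁) (ℕ.*-distribˡ-+ x p₁ p₀) ⟩
    (x ℕ.* p₁ ℕ.+ x ℕ.* p₀) ℕ.+ y ℕ.* p₁ ∎)
    where
    open ≡-Reasoning
    open Data.Nat.Solver.+-*-Solver
    p₀ = P (path n) x y
    p₁ = P (path (suc n)) x y
    p₂ = P (path (suc (suc n))) x y
    total : p₂ ℕ.+ p₁ ≡ sum {x} (λ c → if y ℕ.<ᵇ colour c then p₁ ℕ.+ p₀ else p₁)
    total = begin
      p₂ ℕ.+ p₁
        ≡⟨ cong₂ ℕ._+_ (pathCount-suc (suc n)) (pathCount-suc n) ⟩
      sum (extensions (suc n)) ℕ.+ sum (extensions n)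
        ≡⟨ ∑-distrib-+ (extensions (suc n)) (extensions n) ⟨
      sum (λ c → extensions (suc n) c ℕ.+ extensions n c)
        ≡⟨ sum-cong-≗ (extensions-sum n) ⟩
      sum {x} (λ c → if y ℕ.<ᵇ colour c then p₁ ℕ.+ p₀ else p₁) ∎

-- Cauchy reals

open Data.Rational.Solver.+-*-Solver using (solve; _:=_; _:+_; _:*_; _:-_; :-_; con)

-- Arithmetic on reals acts termwise, so this reduces ring identities between reals to identities of
-- rationals, which the solver proves.
pointwise : ∀ a b → (∀ n → seq a n ≡ seq b n) → a ≃ b
pointwise a b a≡b ε 0<ε = 0 , λ n _ → subst (λ q → ℚ.∣ q ∣ ℚ.< ε)
  (sym (trans (cong (ℚ._- seq b n) (a≡b n)) (ℚ.+-inverseʳ (seq b n)))) 0<ε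

≃-refl : ∀ a → a ≃ a
≃-refl a = pointwise a a λ _ → refl

≃-sym : ∀ a b → a ≃ b → b ≃ a
≃-sym a b a≃b ε 0<ε with a≃b ε 0<ε
... | N , close = N , λ n h → subst (ℚ._< ε) (∣p-q∣≡∣q-p∣ (seq a n) (seq b n)) (close n h)

≃-trans : ∀ a b c → a ≃ b → b ≃ c → a ≃ c
≃-trans a b c a≃b b≃c ε 0<ε with a≃b (½ ℚ.* ε) (half-pos 0<ε) | b≃c (½ ℚ.* ε) (half-pos 0<ε)
... | N , f | M , g = N ℕ.⊔ M , λ n h → subst₂ ℚ._<_
  (cong ℚ.∣_∣ (telescope (seq a n) (seq b n) (seq c n)))
  (half+half ε)
  (∣∣-+-< (seq a n ℚ.- seq b n) (seq b n ℚ.- seq c n) (f n (⊔≤ˡ N M h)) (g n (⊔≤ʳ N M h)))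
  where
  telescope : ∀ p q r → (p ℚ.- q) ℚ.+ (q ℚ.- r) ≡ p ℚ.- r
  telescope = solve 3 (λ p q r → (p :- q) :+ (q :- r) := p :- r) refl

+-cong : ∀ a b c d → a ≃ b → c ≃ d → a + c ≃ b + d
+-cong a b c d a≃b c≃d ε 0<ε with a≃b (½ ℚ.* ε) (half-pos 0<ε) | c≃d (½ ℚ.* ε) (half-pos 0<ε)
... | N , f | M , g = N ℕ.⊔ M , λ n h → subst₂ ℚ._<_
  (cong ℚ.∣_∣ (+-diff (seq a n) (seq c n) (seq b n) (seq d n)))
  (half+half ε)
  (∣∣-+-< (seq a n ℚ.- seq b n) (seq c n ℚ.- seq d n) (f n (⊔≤ˡ N M h)) (g n (⊔≤ʳ N M h)))

-- The error `a c − b d` equals `(a − b) c + (c − d) b`. Since `c` and `b` are eventually bounded by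
-- `C` and `B`, the choice of `δ` and `η` keeps each summand below half of `ε`.
*-cong : ∀ a b c d → a ≃ b → c ≃ d → a * c ≃ b * d
*-cong a b c d a≃b c≃d ε 0<ε =
  let B , 0<B , N₁ , b<B = bounded {seq b} (cauchy b)
      C , 0<C , N₂ , c<C = bounded {seq c} (cauchy c)
      δ , 0<δ , δC = divide-pos (½ ℚ.* ε) C (half-pos 0<ε) 0<C
      η , 0<η , ηB = divide-pos (½ ℚ.* ε) B (half-pos 0<ε) 0<B
      N₃ , f = a≃b δ 0<δ
      N₄ , g = c≃d η 0<η
  in (N₁ ℕ.⊔ N₂) ℕ.⊔ (N₃ ℕ.⊔ N₄) , λ n h →
    let h₁₂ = ⊔≤ˡ (N₁ ℕ.⊔ N₂) (N₃ ℕ.⊔ N₄) h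
        h₃₄ = ⊔≤ʳ (N₁ ℕ.⊔ N₂) (N₃ ℕ.⊔ N₄) h
    in subst (ℚ.∣ seq a n ℚ.* seq c n ℚ.- seq b n ℚ.* seq d n ∣ ℚ.<_)
      (trans (cong₂ ℚ._+_ δC ηB) (half+half ε))
      (*-dist (seq a n) (seq c n) (seq b n) (seq d n) 0<δ 0<η
        (f n (⊔≤ˡ N₃ N₄ h₃₄)) (g n (⊔≤ʳ N₃ N₄ h₃₄))
        (c<C n (⊔≤ʳ N₁ N₂ h₁₂)) (b<B n (⊔≤ˡ N₁ N₂ h₁₂)))

≃-setoid : Setoid 0ℓ 0ℓ
≃-setoid = record
  { Carrier = ℝ
  ; _≈_ = _≃_
  ; isEquivalence = record
    { refl  = λ {a} → ≃-refl a
    ; sym   = λ {a} {b} → ≃-sym a b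
    ; trans = λ {a} {b} {c} → ≃-trans a b c
    }
  }

module ≃-Reasoning = Relation.Binary.Reasoning.Setoid ≃-setoid

-- From index `N` on the terms stay away from 0, so `recip` is a true inverse there and the product
-- is exactly 1; earlier terms may meet the default `recip 0ℚ = 0ℚ`.
inverseʳ : ∀ a (a#0 : a # 0ℝ) → a * inverse a a#0 ≃ 1ℝ
inverseʳ a (δ , 0<δ , N , away) ε 0<ε = N , λ n h → subst (λ q → ℚ.∣ q ∣ ℚ.< ε)
  (sym (trans (cong (ℚ._- 1ℚ) (recip-inverse (seq a n) (ℚ.<-≤-trans 0<δ
    (subst (λ q → δ ℚ.≤ ℚ.∣ q ∣) (ℚ.+-identityʳ (seq a n)) (away n h))))) (ℚ.+-inverseʳ 1ℚ)))
  0<ε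

-- Square roots from enclosures

squeeze : ∀ a b c → (∀ n → seq a n ℚ.≤ seq b n) → (∀ n → seq b n ℚ.≤ seq c n) → c ≃ a → b ≃ a
squeeze a b c a≤b b≤c c≃a ε 0<ε with c≃a ε 0<ε
... | N , close = N , λ n h → <⇒dist (seq b n) (seq a n)
  (ℚ.≤-<-trans (b≤c n) (dist⇒< (seq c n) (seq a n) (close n h)))
  (ℚ.≤-<-trans (a≤b n) (subst (ℚ._< seq b n ℚ.+ ε) (ℚ.+-identityʳ (seq b n)) (ℚ.+-monoʳ-< (seq b n) 0<ε)))

-- Used in both directions, it shows that two positive numbers below `ε` differ by less than `ε`.
p<q+p : ∀ p q {ε} → 0ℚ ℚ.< q → p ℚ.< ε → p ℚ.< q ℚ.+ ε
p<q+p p q {ε} 0<q p<ε = subst (ℚ._< q ℚ.+ ε) (ℚ.+-identityˡ p) (ℚ.+-mono-< 0<q p<ε)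

-- Enclosures r n ≤ √ (a n) < r n + w n whose widths tend to 0.
module Enclosure
  (a r : ℝ) (w : ℕ → ℚ)
  (0<w : ∀ n → 0ℚ ℚ.< w n)
  (w→0 : ∀ ε → 0ℚ ℚ.< ε → ∃[ N ] ∀ n → N ℕ.≤ n → w n ℚ.< ε)
  (0≤r : ∀ n → 0ℚ ℚ.≤ seq r n)
  (r²≤a : ∀ n → seq r n ℚ.* seq r n ℚ.≤ seq a n)
  (a<[r+w]² : ∀ n → seq a n ℚ.< (seq r n ℚ.+ w n) ℚ.* (seq r n ℚ.+ w n))
  where

  private
    gap : ℝ
    gap = mkℝ w λ ε 0<ε → let N , small = w→0 ε 0<ε in N , λ m n hm hn →
      <⇒dist (w m) (w n) (p<q+p (w m) (w n) (0<w n) (small m hm)) (p<q+p (w n) (w m) (0<w m) (small n hn))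

    gap≃0 : gap ≃ 0ℝ
    gap≃0 ε 0<ε = let N , small = w→0 ε 0<ε in N , λ n h → <⇒dist (w n) 0ℚ
      (subst (w n ℚ.<_) (sym (ℚ.+-identityˡ ε)) (small n h))
      (p<q+p 0ℚ (w n) (0<w n) 0<ε)

    r+gap≃r : r + gap ≃ r
    r+gap≃r = ≃-trans (r + gap) (r + 0ℝ) r
      (+-cong r r gap 0ℝ (≃-refl r) gap≃0)
      (pointwise (r + 0ℝ) r λ n → ℚ.+-identityʳ (seq r n))

  -- Termwise, `a` lies between `r * r` and `(r + gap) * (r + gap)`, and these are equal reals
  -- because `gap` is 0.
  r²≃a : r * r ≃ a
  r²≃a = ≃-sym a (r * r) (squeeze (r * r) a ((r + gap) * (r + gap)) r²≤a
    (λ n → ℚ.<⇒≤ (a<[r+w]² n)) (*-cong (r + gap) r (r + gap) r r+gap≃r r+gap≃r))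

  -- Once `w n` is below 1/2, a value of `r` below 1/2 would give `a < (r + w)² ≤ 1`, against
  -- `1 ≤ a`. So eventually `r` is at least 1/2, and 1 serves as the apartness bound for `2 r`.
  2r#0 : (∀ n → 1ℚ ℚ.≤ seq a n) → 2ℝ * r # 0ℝ
  2r#0 1≤a = let N , small = w→0 ½ (half-pos 0<1) in 1ℚ , 0<1 , N , λ n h → ℚ.≤-trans
    (subst (1ℚ ℚ.≤_) (sym (ℚ.+-identityʳ (fromℕ-ℚ 2 ℚ.* seq r n)))
      (ℚ.*-monoˡ-≤-nonNeg (fromℕ-ℚ 2) (½≤r n (small n h))))
    (p≤∣p∣ (fromℕ-ℚ 2 ℚ.* seq r n ℚ.- 0ℚ))
    where
    ½≤r : ∀ n → w n ℚ.< ½ → ½ ℚ.≤ seq r n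
    ½≤r n w<½ = decidable-stable (½ ℚ.≤? seq r n) λ ½≰r →
      let r+w≤1 = ℚ.<⇒≤ (ℚ.+-mono-< (ℚ.≰⇒> ½≰r) w<½)
          0≤r+w = ℚ.+-mono-≤ (0≤r n) (ℚ.<⇒≤ (0<w n))
      in ℚ.<-irrefl refl (ℚ.≤-<-trans (1≤a n) (ℚ.<-≤-trans (a<[r+w]² n)
           (*-mono-≤ 0≤r+w (ℚ.<⇒≤ 0<1) r+w≤1 r+w≤1)))

-- `√` bisects for the clipped term `0ℚ ⊔ seq a n`; nonnegativity of the terms identifies it with
-- `seq a n`.
module √-Enclosure (a : ℝ) (0≤a : ∀ n → 0ℚ ℚ.≤ seq a n) =
  Enclosure a (√ a) (λ n → width (0ℚ ℚ.⊔ seq a n) n)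
    (λ n → width-pos (0ℚ ℚ.⊔ seq a n) (ℚ.p≤p⊔q 0ℚ (seq a n)) n)
    (width-small {seq a} (cauchy a))
    (λ n → lower-nonNeg (0ℚ ℚ.⊔ seq a n) (ℚ.p≤p⊔q 0ℚ (seq a n)) n)
    (λ n → subst (lower (0ℚ ℚ.⊔ seq a n) n ℚ.* lower (0ℚ ℚ.⊔ seq a n) n ℚ.≤_) (ℚ.p≤q⇒p⊔q≡q (0≤a n))
      (lower² (0ℚ ℚ.⊔ seq a n) (ℚ.p≤p⊔q 0ℚ (seq a n)) n))
    (λ n → subst (ℚ._< (lower (0ℚ ℚ.⊔ seq a n) n ℚ.+ width (0ℚ ℚ.⊔ seq a n) n)
                   ℚ.* (lower (0ℚ ℚ.⊔ seq a n) n ℚ.+ width (0ℚ ℚ.⊔ seq a n) n)) (ℚ.p≤q⇒p⊔q≡q (0≤a n))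
      (upper² (0ℚ ℚ.⊔ seq a n) (ℚ.p≤p⊔q 0ℚ (seq a n)) n))

recurrence-unique : ∀ (p q : ℝ) (u v : ℕ → ℝ) →
  (∀ n → u (suc (suc n)) ≃ p * u (suc n) + q * u n) →
  (∀ n → v (suc (suc n)) ≃ p * v (suc n) + q * v n) →
  u 0 ≃ v 0 → u 1 ≃ v 1 → ∀ n → u n ≃ v n
recurrence-unique p q u v u-rec v-rec u₀≃v₀ u₁≃v₁ n = proj₁ (pairs n)
  where
  open ≃-Reasoning
  pairs : ∀ n → u n ≃ v n × u (suc n) ≃ v (suc n)
  pairs zero    = u₀≃v₀ , u₁≃v₁
  pairs (suc n) with pairs n
  ... | uₙ≃vₙ , uₙ₊₁≃vₙ₊₁ = uₙ₊₁≃vₙ₊₁ , (begin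
    u (suc (suc n))
      ≈⟨ u-rec n ⟩
    p * u (suc n) + q * u n
      ≈⟨ +-cong (p * u (suc n)) (p * v (suc n)) (q * u n) (q * v n)
           (*-cong p p (u (suc n)) (v (suc n)) (≃-refl p) uₙ₊₁≃vₙ₊₁)
           (*-cong q q (u n) (v n) (≃-refl q) uₙ≃vₙ) ⟩
    p * v (suc n) + q * v n
      ≈⟨ v-rec n ⟨
    v (suc (suc n)) ∎)

-- Embedding the naturals, and positivity of the discriminant

fromℕ-ℚ-+ : ∀ m n → fromℕ-ℚ (m ℕ.+ n) ≡ fromℕ-ℚ m ℚ.+ fromℕ-ℚ n
fromℕ-ℚ-+ zero    n = sym (ℚ.+-identityˡ (fromℕ-ℚ n))
fromℕ-ℚ-+ (suc m) n = trans (fromℕ-ℚ-suc (m ℕ.+ n)) (trans (cong (1ℚ ℚ.+_) (fromℕ-ℚ-+ m n))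
  (trans (sym (ℚ.+-assoc 1ℚ (fromℕ-ℚ m) (fromℕ-ℚ n))) (cong (ℚ._+ fromℕ-ℚ n) (sym (fromℕ-ℚ-suc m)))))

fromℕ-ℚ-* : ∀ m n → fromℕ-ℚ (m ℕ.* n) ≡ fromℕ-ℚ m ℚ.* fromℕ-ℚ n
fromℕ-ℚ-* zero    n = sym (ℚ.*-zeroˡ (fromℕ-ℚ n))
fromℕ-ℚ-* (suc m) n = trans (fromℕ-ℚ-+ n (m ℕ.* n)) (trans (cong (fromℕ-ℚ n ℚ.+_) (fromℕ-ℚ-* m n))
  (trans (distrib (fromℕ-ℚ m) (fromℕ-ℚ n)) (cong (ℚ._* fromℕ-ℚ n) (sym (fromℕ-ℚ-suc m)))))
  where
  distrib : ∀ p q → q ℚ.+ p ℚ.* q ≡ (1ℚ ℚ.+ p) ℚ.* q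
  distrib = solve 2 (λ p q → q :+ p :* q := (con 1ℚ :+ p) :* q) refl

-- 4 y ≤ 4 x ≤ (x + 1)² − (x − 1)², and (x − 1)² is positive unless x = 1.
1+4y≤[x+1]² : ∀ x y → y ℕ.≤ x → ¬ (x ≡ 1 × y ≡ 1) → 1 ℕ.+ 4 ℕ.* y ℕ.≤ (x ℕ.+ 1) ℕ.* (x ℕ.+ 1)
1+4y≤[x+1]² zero          zero          _ _ = ℕ.≤-refl
1+4y≤[x+1]² (suc zero)    zero          _ _ = ℕ.s≤s ℕ.z≤n
1+4y≤[x+1]² (suc zero)    (suc zero)    _ x,y≢1,1 = ⊥-elim (x,y≢1,1 (refl , refl))
1+4y≤[x+1]² (suc zero)    (suc (suc y)) (ℕ.s≤s ()) _
1+4y≤[x+1]² (suc (suc k)) y             y≤x _ = begin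
  1 ℕ.+ 4 ℕ.* y          ≤⟨ ℕ.s≤s (ℕ.*-monoʳ-≤ 4 y≤x) ⟩
  1 ℕ.+ 4 ℕ.* (2 ℕ.+ k)  ≤⟨ ℕ.m≤m+n _ (k ℕ.* k ℕ.+ 2 ℕ.* k) ⟩
  1 ℕ.+ 4 ℕ.* (2 ℕ.+ k) ℕ.+ (k ℕ.* k ℕ.+ 2 ℕ.* k) ≡⟨ expand k ⟩
  (2 ℕ.+ k ℕ.+ 1) ℕ.* (2 ℕ.+ k ℕ.+ 1)  ∎
  where
  open ℕ.≤-Reasoning
  module S = Data.Nat.Solver.+-*-Solver
  expand : ∀ k → 1 ℕ.+ 4 ℕ.* (2 ℕ.+ k) ℕ.+ (k ℕ.* k ℕ.+ 2 ℕ.* k) ≡ (2 ℕ.+ k ℕ.+ 1) ℕ.* (2 ℕ.+ k ℕ.+ 1)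
  expand = S.solve 1 (λ k →
    S.con 1 S.:+ S.con 4 S.:* (S.con 2 S.:+ k) S.:+ (k S.:* k S.:+ S.con 2 S.:* k)
    S.:= (S.con 2 S.:+ k S.:+ S.con 1) S.:* (S.con 2 S.:+ k S.:+ S.con 1)) refl

discriminant : ℕ → ℕ → ℝ
discriminant x y = (fromℕ x + 1ℝ) ^ 2 - 4ℝ * fromℕ y

-- All terms of the sequence are the same integer, so the natural-number inequality carries over to
-- ℚ, where `4y` can be subtracted.
1≤discriminant : ∀ x y → y ℕ.≤ x → ¬ (x ≡ 1 × y ≡ 1) → ∀ n → 1ℚ ℚ.≤ seq (discriminant x y) n
1≤discriminant x y y≤x x,y≢1,1 _ = subst₂ ℚ._≤_
  (trans (cong (ℚ._- 4y) (trans (fromℕ-ℚ-+ 1 (4 ℕ.* y)) (cong (1ℚ ℚ.+_) (fromℕ-ℚ-* 4 y)))) (cancel 4y))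
  (cong (ℚ._- 4y) (trans (fromℕ-ℚ-* (x ℕ.+ 1) (x ℕ.+ 1))
    (trans (cong (λ q → q ℚ.* q) (fromℕ-ℚ-+ x 1)) (square (fromℕ-ℚ x ℚ.+ 1ℚ)))))
  (ℚ.+-monoˡ-≤ (ℚ.- 4y) (fromℕ-ℚ-mono (1+4y≤[x+1]² x y y≤x x,y≢1,1)))
  where
  4y = fromℕ-ℚ 4 ℚ.* fromℕ-ℚ y
  cancel : ∀ p → (1ℚ ℚ.+ p) ℚ.- p ≡ 1ℚ
  cancel = solve 1 (λ p → (con 1ℚ :+ p) :- p := con 1ℚ) refl
  -- The power `p ^ 2` unfolds to this product with a trailing factor 1.
  square : ∀ p → p ℚ.* p ≡ p ℚ.* (p ℚ.* 1ℚ)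
  square = solve 1 (λ p → p :* p := p :* (p :* con 1ℚ)) refl

-- The closed form

module _ (A B α β p q : ℝ) (α+β≃p : α + β ≃ p) (-αβ≃q : - (α * β) ≃ q) where

  private
    G : ℕ → ℝ
    G n = A * α ^ n + B * β ^ n

  -- With the coefficients `α + β` and `- (α * β)` themselves the recurrence is a ring identity and
  -- holds termwise; `p` and `q` equal them only up to `≃` and enter by congruence.
  geometric-recurrence : ∀ n → G (suc (suc n)) ≃ p * G (suc n) + q * G n
  geometric-recurrence n = ≃-trans (G (suc (suc n)))
    ((α + β) * G (suc n) + - (α * β) * G n)
    (p * G (suc n) + q * G n)
    (pointwise (G (suc (suc n))) ((α + β) * G (suc n) + - (α * β) * G n)
      λ k → identity (seq A k) (seq B k) (seq α k) (seq β k) (seq (α ^ n) k) (seq (β ^ n) k))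
    (+-cong ((α + β) * G (suc n)) (p * G (suc n)) (- (α * β) * G n) (q * G n)
      (*-cong (α + β) p (G (suc n)) (G (suc n)) α+β≃p (≃-refl (G (suc n))))
      (*-cong (- (α * β)) q (G n) (G n) -αβ≃q (≃-refl (G n))))
    where
    identity : ∀ A B a b p q → A ℚ.* (a ℚ.* (a ℚ.* p)) ℚ.+ B ℚ.* (b ℚ.* (b ℚ.* q)) ≡
      (a ℚ.+ b) ℚ.* (A ℚ.* (a ℚ.* p) ℚ.+ B ℚ.* (b ℚ.* q)) ℚ.+ ℚ.- (a ℚ.* b) ℚ.* (A ℚ.* p ℚ.+ B ℚ.* q)
    identity = solve 6 (λ A B a b p q → A :* (a :* (a :* p)) :+ B :* (b :* (b :* q)) :=
      (a :+ b) :* (A :* (a :* p) :+ B :* (b :* q)) :+ :- (a :* b) :* (A :* p :+ B :* q)) refl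

  recurrence⇒geometric : (u : ℕ → ℝ) → u 0 ≃ A + B → u 1 ≃ A * α + B * β →
    (∀ n → u (suc (suc n)) ≃ p * u (suc n) + q * u n) → ∀ n → u n ≃ A * α ^ n + B * β ^ n
  recurrence⇒geometric u u₀≃ u₁≃ u-rec = recurrence-unique p q u G u-rec geometric-recurrence
    (≃-trans (u 0) (A + B) (G 0) u₀≃ (pointwise (A + B) (G 0) λ n → unit₀ (seq A n) (seq B n)))
    (≃-trans (u 1) (A * α + B * β) (G 1) u₁≃
      (pointwise (A * α + B * β) (G 1) λ n → unit₁ (seq A n) (seq B n) (seq α n) (seq β n)))
    where
    unit₀ : ∀ A B → A ℚ.+ B ≡ A ℚ.* 1ℚ ℚ.+ B ℚ.* 1ℚ
    unit₀ = solve 2 (λ A B → A :+ B := A :* con 1ℚ :+ B :* con 1ℚ) refl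
    unit₁ : ∀ A B a b → A ℚ.* a ℚ.+ B ℚ.* b ≡ A ℚ.* (a ℚ.* 1ℚ) ℚ.+ B ℚ.* (b ℚ.* 1ℚ)
    unit₁ = solve 4 (λ A B a b → A :* a :+ B :* b := A :* (a :* con 1ℚ) :+ B :* (b :* con 1ℚ)) refl

module _ (X s : ℝ) (2s#0 : 2ℝ * s # 0ℝ) where

  private
    t : ℝ
    t = inverse (2ℝ * s) 2s#0

    2s*t≃1 : 2ℝ * s * t ≃ 1ℝ
    2s*t≃1 = inverseʳ (2ℝ * s) 2s#0

  -- The numerators add up to `2 s`. This is the initial value at `n = 0`.
  coefficients-sum : 1ℝ ≃ (s - X - 1ℝ) ÷ (2ℝ * s) [ 2s#0 ] + (s + X + 1ℝ) ÷ (2ℝ * s) [ 2s#0 ]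
  coefficients-sum = begin
    1ℝ          ≈⟨ 2s*t≃1 ⟨
    2ℝ * s * t  ≈⟨ pointwise (2ℝ * s * t) ((s - X - 1ℝ) * t + (s + X + 1ℝ) * t)
                     (λ n → identity (seq X n) (seq s n) (seq t n)) ⟩
    (s - X - 1ℝ) * t + (s + X + 1ℝ) * t ∎
    where
    open ≃-Reasoning
    identity : ∀ X s t → fromℕ-ℚ 2 ℚ.* s ℚ.* t ≡ (s ℚ.- X ℚ.- 1ℚ) ℚ.* t ℚ.+ (s ℚ.+ X ℚ.+ 1ℚ) ℚ.* t
    identity = solve 3 (λ X s t →
      con (fromℕ-ℚ 2) :* s :* t := (s :- X :- con 1ℚ) :* t :+ (s :+ X :+ con 1ℚ) :* t) refl

  -- This is the initial value at `n = 1`: `(s − X − 1)(X − 1 − s) + (s + X + 1)(X − 1 + s) = 4 s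
  -- X`.
  coefficients-first :
    X ≃ ((s - X - 1ℝ) ÷ (2ℝ * s) [ 2s#0 ]) * ((X - 1ℝ - s) ÷ 2ℝ [ 2#0 ])
        + ((s + X + 1ℝ) ÷ (2ℝ * s) [ 2s#0 ]) * ((X - 1ℝ + s) ÷ 2ℝ [ 2#0 ])
  coefficients-first = begin
    X                 ≈⟨ pointwise X (X * 1ℝ) (λ n → sym (ℚ.*-identityʳ (seq X n))) ⟩
    X * 1ℝ            ≈⟨ *-cong X X (2ℝ * s * t) 1ℝ (≃-refl X) 2s*t≃1 ⟨
    X * (2ℝ * s * t)  ≈⟨ pointwise (X * (2ℝ * s * t))
                           ((s - X - 1ℝ) * t * ((X - 1ℝ - s) ÷ 2ℝ [ 2#0 ]) + (s + X + 1ℝ) * t * ((X - 1ℝ + s) ÷ 2ℝ [ 2#0 ]))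
                           (λ n → identity (seq X n) (seq s n) (seq t n)) ⟩
    (s - X - 1ℝ) * t * ((X - 1ℝ - s) ÷ 2ℝ [ 2#0 ]) + (s + X + 1ℝ) * t * ((X - 1ℝ + s) ÷ 2ℝ [ 2#0 ]) ∎
    where
    open ≃-Reasoning
    -- Each term of `inverse 2ℝ 2#0` computes to `½`.
    identity : ∀ X s t → X ℚ.* (fromℕ-ℚ 2 ℚ.* s ℚ.* t) ≡
      (s ℚ.- X ℚ.- 1ℚ) ℚ.* t ℚ.* ((X ℚ.- 1ℚ ℚ.- s) ℚ.* ½) ℚ.+ (s ℚ.+ X ℚ.+ 1ℚ) ℚ.* t ℚ.* ((X ℚ.- 1ℚ ℚ.+ s) ℚ.* ½)
    identity = solve 3 (λ X s t → X :* (con (fromℕ-ℚ 2) :* s :* t) :=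
      (s :- X :- con 1ℚ) :* t :* ((X :- con 1ℚ :- s) :* con ½) :+
      (s :+ X :+ con 1ℚ) :* t :* ((X :- con 1ℚ :+ s) :* con ½)) refl

module _ (X Y s : ℝ) where

  roots-sum : (X - 1ℝ - s) ÷ 2ℝ [ 2#0 ] + (X - 1ℝ + s) ÷ 2ℝ [ 2#0 ] ≃ X - 1ℝ
  roots-sum = pointwise ((X - 1ℝ - s) ÷ 2ℝ [ 2#0 ] + (X - 1ℝ + s) ÷ 2ℝ [ 2#0 ]) (X - 1ℝ) λ n → identity (seq X n) (seq s n)
    where
    identity : ∀ X s → (X ℚ.- 1ℚ ℚ.- s) ℚ.* ½ ℚ.+ (X ℚ.- 1ℚ ℚ.+ s) ℚ.* ½ ≡ X ℚ.- 1ℚ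
    identity = solve 2 (λ X s →
      (X :- con 1ℚ :- s) :* con ½ :+ (X :- con 1ℚ :+ s) :* con ½ := X :- con 1ℚ) refl

  -- The left side is `(s² − (X − 1)²) / 4`. Replacing `s²` by the discriminant and using
  -- `(X + 1)² − (X − 1)² = 4 X` leaves `X − Y`. The value of `s²` is known only up to `≃`, so its
  -- replacement separates two termwise identities.
  roots-product : s * s ≃ (X + 1ℝ) ^ 2 - 4ℝ * Y →
    - (((X - 1ℝ - s) ÷ 2ℝ [ 2#0 ]) * ((X - 1ℝ + s) ÷ 2ℝ [ 2#0 ])) ≃ X - Y
  roots-product s²≃ = begin
    - (((X - 1ℝ - s) ÷ 2ℝ [ 2#0 ]) * ((X - 1ℝ + s) ÷ 2ℝ [ 2#0 ]))
      ≈⟨ pointwise (- (((X - 1ℝ - s) ÷ 2ℝ [ 2#0 ]) * ((X - 1ℝ + s) ÷ 2ℝ [ 2#0 ]))) ((s * s + c) * ¼) (λ n → expand (seq X n) (seq s n)) ⟩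
    (s * s + c) * ¼
      ≈⟨ *-cong (s * s + c) (D + c) ¼ ¼ (+-cong (s * s) D c c s²≃ (≃-refl c)) (≃-refl ¼) ⟩
    (D + c) * ¼
      ≈⟨ pointwise ((D + c) * ¼) (X - Y) (λ n → collect (seq X n) (seq Y n)) ⟩
    X - Y ∎
    where
    open ≃-Reasoning
    c ¼ D : ℝ
    c = - ((X - 1ℝ) * (X - 1ℝ))
    ¼ = fromℚ (½ ℚ.* ½)
    D = (X + 1ℝ) ^ 2 - 4ℝ * Y
    expand : ∀ X s → ℚ.- ((X ℚ.- 1ℚ ℚ.- s) ℚ.* ½ ℚ.* ((X ℚ.- 1ℚ ℚ.+ s) ℚ.* ½)) ≡
      (s ℚ.* s ℚ.- (X ℚ.- 1ℚ) ℚ.* (X ℚ.- 1ℚ)) ℚ.* (½ ℚ.* ½)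
    expand = solve 2 (λ X s →
      :- ((X :- con 1ℚ :- s) :* con ½ :* ((X :- con 1ℚ :+ s) :* con ½)) :=
      (s :* s :- (X :- con 1ℚ) :* (X :- con 1ℚ)) :* con (½ ℚ.* ½)) refl
    collect : ∀ X Y → ((X ℚ.+ 1ℚ) ℚ.* ((X ℚ.+ 1ℚ) ℚ.* 1ℚ) ℚ.- fromℕ-ℚ 4 ℚ.* Y ℚ.- (X ℚ.- 1ℚ) ℚ.* (X ℚ.- 1ℚ))
      ℚ.* (½ ℚ.* ½) ≡ X ℚ.- Y
    collect = solve 2 (λ X Y →
      ((X :+ con 1ℚ) :* ((X :+ con 1ℚ) :* con 1ℚ) :- con (fromℕ-ℚ 4) :* Y :- (X :- con 1ℚ) :* (X :- con 1ℚ))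
      :* con (½ ℚ.* ½) := X :- Y) refl

closed-form : ∀ (X Y s : ℝ) (2s#0 : 2ℝ * s # 0ℝ) → s * s ≃ (X + 1ℝ) ^ 2 - 4ℝ * Y →
  (p : ℕ → ℝ) → p 0 ≃ 1ℝ → p 1 ≃ X →
  (∀ n → p (suc (suc n)) ≃ (X - 1ℝ) * p (suc n) + (X - Y) * p n) → ∀ n →
  p n ≃ ((s - X - 1ℝ) ÷ (2ℝ * s) [ 2s#0 ]) * (((X - 1ℝ - s) ÷ 2ℝ [ 2#0 ]) ^ n)
        + ((s + X + 1ℝ) ÷ (2ℝ * s) [ 2s#0 ]) * (((X - 1ℝ + s) ÷ 2ℝ [ 2#0 ]) ^ n)
closed-form X Y s 2s#0 s²≃ p p₀≃1 p₁≃X = recurrence⇒geometric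
  ((s - X - 1ℝ) ÷ (2ℝ * s) [ 2s#0 ]) ((s + X + 1ℝ) ÷ (2ℝ * s) [ 2s#0 ])
  ((X - 1ℝ - s) ÷ 2ℝ [ 2#0 ]) ((X - 1ℝ + s) ÷ 2ℝ [ 2#0 ])
  (X - 1ℝ) (X - Y) (roots-sum X Y s) (roots-product X Y s s²≃) p
  (≃-trans (p 0) 1ℝ ((s - X - 1ℝ) ÷ (2ℝ * s) [ 2s#0 ] + (s + X + 1ℝ) ÷ (2ℝ * s) [ 2s#0 ])
    p₀≃1 (coefficients-sum X s 2s#0))
  (≃-trans (p 1) X
    (((s - X - 1ℝ) ÷ (2ℝ * s) [ 2s#0 ]) * ((X - 1ℝ - s) ÷ 2ℝ [ 2#0 ])
      + ((s + X + 1ℝ) ÷ (2ℝ * s) [ 2s#0 ]) * ((X - 1ℝ + s) ÷ 2ℝ [ 2#0 ]))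
    p₁≃X (coefficients-first X s 2s#0))

-- Path counts as real numbers and their closed form

fromℕ-pathCount-recurrence : ∀ x y → y ℕ.≤ x → ∀ n →
  fromℕ (P (path (suc (suc n))) x y) ≃
  (fromℕ x - 1ℝ) * fromℕ (P (path (suc n)) x y) + (fromℕ x - fromℕ y) * fromℕ (P (path n) x y)
fromℕ-pathCount-recurrence x y y≤x n =
  pointwise (fromℕ p₂) ((fromℕ x - 1ℝ) * fromℕ p₁ + (fromℕ x - fromℕ y) * fromℕ p₀) λ _ →
    isolate (fromℕ-ℚ x) (fromℕ-ℚ y) (fromℕ-ℚ p₀) (fromℕ-ℚ p₁) (fromℕ-ℚ p₂) (begin
      fromℕ-ℚ p₂ ℚ.+ fromℕ-ℚ p₁ ℚ.+ fromℕ-ℚ y ℚ.* fromℕ-ℚ p₀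
        ≡⟨ cong₂ ℚ._+_ (fromℕ-ℚ-+ p₂ p₁) (fromℕ-ℚ-* y p₀) ⟨
      fromℕ-ℚ (p₂ ℕ.+ p₁) ℚ.+ fromℕ-ℚ (y ℕ.* p₀)
        ≡⟨ fromℕ-ℚ-+ (p₂ ℕ.+ p₁) (y ℕ.* p₀) ⟨
      fromℕ-ℚ (p₂ ℕ.+ p₁ ℕ.+ y ℕ.* p₀)
        ≡⟨ cong fromℕ-ℚ (pathCount-recurrence x y y≤x n) ⟩
      fromℕ-ℚ (x ℕ.* p₁ ℕ.+ x ℕ.* p₀)
        ≡⟨ fromℕ-ℚ-+ (x ℕ.* p₁) (x ℕ.* p₀) ⟩
      fromℕ-ℚ (x ℕ.* p₁) ℚ.+ fromℕ-ℚ (x ℕ.* p₀)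
        ≡⟨ cong₂ ℚ._+_ (fromℕ-ℚ-* x p₁) (fromℕ-ℚ-* x p₀) ⟩
      fromℕ-ℚ x ℚ.* fromℕ-ℚ p₁ ℚ.+ fromℕ-ℚ x ℚ.* fromℕ-ℚ p₀ ∎)
  where
  open ≡-Reasoning
  p₀ = P (path n) x y
  p₁ = P (path (suc n)) x y
  p₂ = P (path (suc (suc n))) x y
  -- The subtraction-free recurrence on ℕ is solved for `p₂` only in ℚ, where `x − 1` is not
  -- truncated at `x = 0`.
  isolate : ∀ x y p₀ p₁ p₂ → p₂ ℚ.+ p₁ ℚ.+ y ℚ.* p₀ ≡ x ℚ.* p₁ ℚ.+ x ℚ.* p₀ → p₂ ≡ (x ℚ.- 1ℚ) ℚ.* p₁ ℚ.+ (x ℚ.- y) ℚ.* p₀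
  isolate x y p₀ p₁ p₂ eq = trans (split y p₀ p₁ p₂) (trans (cong (λ q → q ℚ.- p₁ ℚ.- y ℚ.* p₀) eq) (merge x y p₀ p₁))
    where
    split : ∀ y p₀ p₁ p₂ → p₂ ≡ p₂ ℚ.+ p₁ ℚ.+ y ℚ.* p₀ ℚ.- p₁ ℚ.- y ℚ.* p₀
    split = solve 4 (λ y p₀ p₁ p₂ → p₂ := p₂ :+ p₁ :+ y :* p₀ :- p₁ :- y :* p₀) refl
    merge : ∀ x y p₀ p₁ → x ℚ.* p₁ ℚ.+ x ℚ.* p₀ ℚ.- p₁ ℚ.- y ℚ.* p₀ ≡ (x ℚ.- 1ℚ) ℚ.* p₁ ℚ.+ (x ℚ.- y) ℚ.* p₀
    merge = solve 4 (λ x y p₀ p₁ →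
      x :* p₁ :+ x :* p₀ :- p₁ :- y :* p₀ := (x :- con 1ℚ) :* p₁ :+ (x :- y) :* p₀) refl

-- D is a variable tied to its value by an equation: instantiating it by an expression
-- containing ^ would make the conversion checker unfold the rational arithmetic.
closed-form-√ : ∀ (X Y D : ℝ) → D ≡ (X + 1ℝ) ^ 2 - 4ℝ * Y → (∀ k → 1ℚ ℚ.≤ seq D k) →
  (p : ℕ → ℝ) → p 0 ≃ 1ℝ → p 1 ≃ X →
  (∀ n → p (suc (suc n)) ≃ (X - 1ℝ) * p (suc n) + (X - Y) * p n) → ∀ n →
  Σ[ 2s#0 ∈ 2ℝ * √ D # 0ℝ ] p n ≃ ((√ D - X - 1ℝ) ÷ (2ℝ * √ D) [ 2s#0 ]) * (((X - 1ℝ - √ D) ÷ 2ℝ [ 2#0 ]) ^ n)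
        + ((√ D + X + 1ℝ) ÷ (2ℝ * √ D) [ 2s#0 ]) * (((X - 1ℝ + √ D) ÷ 2ℝ [ 2#0 ]) ^ n)
closed-form-√ X Y D D≡ 1≤D p p₀ p₁ p-rec n = 2r#0 1≤D ,
  closed-form X Y (√ D) (2r#0 1≤D) (subst (√ D * √ D ≃_) D≡ r²≃a) p p₀ p₁ p-rec n
  where
  open √-Enclosure D (λ k → ℚ.≤-trans (ℚ.<⇒≤ 0<1) (1≤D k))

theorem1 : ∀ (n x y : ℕ) → 1 ≤ n → y ≤ x → ¬ (x ≡ 1 × y ≡ 1) →
    let X = fromℕ x
        s = √ ((X + 1ℝ) ^ 2 - 4ℝ * fromℕ y)
    in Σ[ 2s#0 ∈ 2ℝ * s # 0ℝ ]
         fromℕ (P (path n) x y) ≃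
           ((s - X - 1ℝ) ÷ (2ℝ * s) [ 2s#0 ]) * (((X - 1ℝ - s) ÷ 2ℝ [ 2#0 ]) ^ n)
           + ((s + X + 1ℝ) ÷ (2ℝ * s) [ 2s#0 ]) * (((X - 1ℝ + s) ÷ 2ℝ [ 2#0 ]) ^ n)
theorem1 n x y _ y≤x x,y≢1,1 = closed-form-√ (fromℕ x) (fromℕ y) _ refl
  (1≤discriminant x y y≤x x,y≢1,1)
  (λ k → fromℕ (P (path k) x y))
  (pointwise (fromℕ (P (path 0) x y)) 1ℝ λ _ → cong fromℕ-ℚ (pathCount-zero x y))
  (pointwise (fromℕ (P (path 1) x y)) (fromℕ x) λ _ → cong fromℕ-ℚ (pathCount-one x y))
  (fromℕ-pathCount-recurrence x y y≤x) n
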